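{- For any fixed integer $n\geq 3$, $\chi_L(T(n,k))=o(k)$ as $k\to\infty$, i.e. $\displaystyle\lim_{k\to\infty}\frac{\chi_L(T(n,k))}{k}=0$.
   Context: All graphs are simple, undirected and connected. A $k$-coloring of a graph $G$ is a map $c:V(G)\to\{1,\dots,k\}$ with $c(u)\neq c(v)$ whenever $u,v$ are adjacent. If $\Pi=\{C_1,\dots,C_k\}$ is the partition of $V(G)$ into color classes, the color code of a vertex $v$ is $(d(v,C_1),\dots,d(v,C_k))$, where $d(v,C_i)=\min\{d(v,x):x\in C_i\}$. The coloring is a locating $k$-coloring if all vertices have distinct color codes, and $\chi_L(G)$ is the smallest $k$ for which $G$ has a locating $k$-coloring. For integers $n\geq 2$, $k\geq 1$, $T(n,k)$ is defined recursively: $T(n,1)$ is the star $K_{1,n}$, and for $k\geq 2$, $T(n,k)$ is obtained from $n$ disjoint copies of $T(n,k-1)$ by adding a new vertex (the center of $T(n,k)$) adjacent to the center of each copy. -}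

module Defs where

open import Data.Nat using (ℕ; zero; suc; _≤_; _<_)
open import Data.Fin using (Fin)
open import Data.Product using (Σ; ∃; ∃-syntax; _×_)
open import Relation.Binary.PropositionalEquality using (_≡_; _≢_)
open import Relation.Nullary using (¬_)

record Graph : Set₁ where
  field
    V   : Set
    Adj : V → V → Set
open Graph public

data Walk (G : Graph) : V G → V G → ℕ → Set where
  here : ∀ {u} → Walk G u u zero
  step : ∀ {u w v ℓ} → Adj G u w → Walk G w v ℓ → Walk G u v (suc ℓ)

DistToClass : (G : Graph) {k : ℕ} (c : V G → Fin k) → V G → Fin k → ℕ → Set
DistToClass G c v i d =
  (∃[ x ] (c x ≡ i × Walk G v x d)) ×
  (∀ x ℓ → c x ≡ i → Walk G v x ℓ → d ≤ ℓ)

-- A locating k-colouring: proper, all k colour classes nonempty (Π is a partition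
-- into k classes), and distinct vertices have distinct colour codes.
IsLocatingColoring : (G : Graph) (k : ℕ) → (V G → Fin k) → Set
IsLocatingColoring G k c =
  (∀ u v → Adj G u v → c u ≢ c v) ×
  (∀ (i : Fin k) → ∃[ x ] c x ≡ i) ×
  (∀ u v → (∀ i d → DistToClass G c u i d → DistToClass G c v i d) → u ≡ v)

HasLocatingColoring : Graph → ℕ → Set
HasLocatingColoring G k = ∃[ c ] IsLocatingColoring G k c

IsLocChromNumber : Graph → ℕ → Set
IsLocChromNumber G χ =
  HasLocatingColoring G χ × (∀ j → j < χ → ¬ HasLocatingColoring G j)

-- Vertices of T(n,k) (meaningful for k ≥ 1):
--   T(n,1) = star: centre plus n leaves;
--   T(n,k+1) = centre plus n copies of T(n,k).
data TV (n : ℕ) : ℕ → Set where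
  center : ∀ {k} → TV n k
  leaf   : Fin n → TV n 1
  copy   : ∀ {k} → Fin n → TV n (suc k) → TV n (suc (suc k))

data TAdj (n : ℕ) : {k : ℕ} → TV n k → TV n k → Set where
  star-cl : ∀ i → TAdj n center (leaf i)
  star-lc : ∀ i → TAdj n (leaf i) center
  root-cc : ∀ {k} i → TAdj n {suc (suc k)} center (copy i center)
  root-ca : ∀ {k} i → TAdj n {suc (suc k)} (copy i center) center
  inside  : ∀ {k} i {u v : TV n (suc k)} → TAdj n u v → TAdj n (copy i u) (copy i v)

T : ℕ → ℕ → Graph
T n k = record { V = TV n k ; Adj = TAdj n {k} }

-- Cut the levels into rounds of Λ = N M levels, where M = 4 m and N = n ^ M. A root path
-- reads N symbols from an alphabet of size N in each round, and the Lehmer code turns them into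
-- N distinct positions p_j < 2 N. Round r gets N private colors "mark r j": below a vertex at
-- level (r + 1) Λ, the whole level (r + 1) Λ + 2 p_j gets the color mark r j. So a vertex deep
-- enough recovers p_j, hence its digits in round r, from its level and its distance to that
-- class. The level is the distance to the root, which has a color of its own. All other
-- vertices get one of boundedly many base colors, recording the level mod 3 and the last 2 Λ + 1
-- digits; a marked vertex still sees its last 2 Λ digits in the base color of a child. The marks
-- use at most (k / Λ) N = k / (4 m) colors.
module Submission where

open import Defs
open import Data.Nat using (ℕ; zero; suc; _+_; _*_; _∸_; _^_; _/_; _%_; _≤_; _<_; z≤n; s≤s; z<s; NonZero; _≤?_; _≟_; >-nonZero)
open import Data.Nat.Properties hiding (_≟_; _≤?_)
open import Data.Nat.DivMod using (m≡m%n+[m/n]*n; m%n<n; m/n*n≤m; m≥n⇒m/n>0)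
open import Data.Nat.Solver using (module +-*-Solver)
open import Data.Fin using (Fin; zero; suc; toℕ; fromℕ<; punchIn; punchOut; _↑ʳ_; combine; remQuot; funToFin; finToFun)
open import Data.Fin.Properties using (toℕ<n; toℕ-injective; toℕ-fromℕ<; ↑ʳ-injective; punchInᵢ≢i; punchIn-injective; punchOut-injective; punchIn-punchOut; any?; all?; ¬∀⟶∃¬; finToFun-funToFin; combine-remQuot; +↔⊎; *↔×)
open import Data.Product using (∃; ∃-syntax; _×_; _,_; proj₁; proj₂)
open import Data.Sum using (_⊎_; inj₁; inj₂)
open import Data.Sum.Function.Propositional using (_⊎-↔_)
open import Function using (_∘_; Inverse; _↔_; Injective)
open import Function.Properties.Inverse using (↔-refl; ↔-sym; ↔-trans; Inverse⇒Injection)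
open import Function.Bundles using (Injection)
open import Relation.Binary.PropositionalEquality using (_≡_; _≢_; refl; sym; trans; cong; cong₂; subst)
open import Relation.Nullary using (¬_; Dec; yes; no; contradiction)
open import Relation.Nullary.Decidable using (map′; _⊎-dec_)
open import Relation.Unary using (Decidable)

-- Color codes and the removal of empty classes.

DistToClass-unique : ∀ {G k} {c : V G → Fin k} {v i d d′} →
  DistToClass G c v i d → DistToClass G c v i d′ → d ≡ d′
DistToClass-unique ((x , cx , w) , min) ((x′ , cx′ , w′) , min′) =
  ≤-antisym (min x′ _ cx′ w′) (min′ x _ cx w)

DistToClass-relabel : ∀ {G k k′} {c : V G → Fin k} {c′ : V G → Fin k′} {i i′} →
  (∀ {x} → c x ≡ i → c′ x ≡ i′) → (∀ {x} → c′ x ≡ i′ → c x ≡ i) →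
  ∀ {v d} → DistToClass G c v i d → DistToClass G c′ v i′ d
DistToClass-relabel to from ((x , cx , w) , min) =
  (x , to cx , w) , λ y ℓ cy → min y ℓ (from cy)

IsProper : (G : Graph) {k : ℕ} → (V G → Fin k) → Set
IsProper G c = ∀ u v → Adj G u v → c u ≢ c v

SeparatesCodes : (G : Graph) {k : ℕ} → (V G → Fin k) → Set
SeparatesCodes G c =
  ∀ u v → (∀ i d → DistToClass G c u i d → DistToClass G c v i d) → u ≡ v

drop-empty-classes : ∀ G → (∀ {P : V G → Set} → Decidable P → Dec (∃ P)) →
  ∀ q (c : V G → Fin q) → IsProper G c → SeparatesCodes G c →
  ∃[ j ] (j ≤ q × HasLocatingColoring G j)
drop-empty-classes G search zero c proper sep =
  zero , z≤n , c , proper , (λ ()) , sep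
drop-empty-classes G search (suc q) c proper sep
  with all? (λ i → search (λ x → c x Data.Fin.≟ i))
... | yes surj = suc q , ≤-refl , c , proper , surj , sep
... | no ¬surj
  with i , empty ← ¬∀⟶∃¬ (suc q) _ (λ i → search (λ x → c x Data.Fin.≟ i)) ¬surj =
  let j , j≤q , col = drop-empty-classes G search q c′ proper′ sep′
  in j , m≤n⇒m≤1+n j≤q , col
  where
  i≢c : ∀ x → i ≢ c x
  i≢c x i≡cx = empty (x , sym i≡cx)

  c′ : V G → Fin q
  c′ x = punchOut (i≢c x)

  proper′ : IsProper G c′
  proper′ u v uv eq = proper u v uv (punchOut-injective (i≢c u) (i≢c v) eq)

  toC : ∀ {x a} → c′ x ≡ a → c x ≡ punchIn i a
  toC {x} eq = trans (sym (punchIn-punchOut (i≢c x))) (cong (punchIn i) eq)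

  fromC : ∀ {x a} → c x ≡ punchIn i a → c′ x ≡ a
  fromC {x} eq = punchIn-injective i _ _ (trans (punchIn-punchOut (i≢c x)) eq)

  sep′ : SeparatesCodes G c′
  sep′ u v same = sep u v same′
    where
    same′ : ∀ a d → DistToClass G c u a d → DistToClass G c v a d
    -- The vertex `x` has color `a`, so `a` is not the missing color `i` and survives in `c′` as
    -- `punchOut (i≢c x)`.
    same′ a d D@((x , refl , _) , _) = subst (λ b → DistToClass G c v b d) eq
      (DistToClass-relabel {G} toC fromC
        (same (punchOut (i≢c x)) d (DistToClass-relabel {G} fromC′ toC′ D)))
      where
      eq = punchIn-punchOut (i≢c x)
      fromC′ : ∀ {y} → c y ≡ c x → c′ y ≡ punchOut (i≢c x)
      fromC′ e = fromC (trans e (sym eq))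
      toC′ : ∀ {y} → c′ y ≡ punchOut (i≢c x) → c y ≡ c x
      toC′ e = trans (toC e) eq

-- Encodings of sequences, and elementary arithmetic.

-- The Lehmer code: sequences of symbols injected into injective sequences of positions.
place : ∀ R {N} → (Fin R → Fin N) → Fin R → Fin (R + N)
place (suc R) s zero    = suc R ↑ʳ s zero
place (suc R) s (suc j) = punchIn (suc R ↑ʳ s zero) (place R (s ∘ suc) j)

place-cong : ∀ R {N} {s t : Fin R → Fin N} → (∀ j → s j ≡ t j) → ∀ j → place R s j ≡ place R t j
place-cong (suc R) s≗t zero    = cong (suc R ↑ʳ_) (s≗t zero)
place-cong (suc R) s≗t (suc j) =
  cong₂ (λ a b → punchIn (suc R ↑ʳ a) b) (s≗t zero) (place-cong R (s≗t ∘ suc) j)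

place-distinct : ∀ R {N} (s : Fin R → Fin N) → Injective _≡_ _≡_ (place R s)
place-distinct (suc R) s {zero}  {zero}  eq = refl
place-distinct (suc R) s {zero}  {suc j} eq = contradiction (sym eq) (punchInᵢ≢i _ _)
place-distinct (suc R) s {suc i} {zero}  eq = contradiction eq (punchInᵢ≢i _ _)
place-distinct (suc R) s {suc i} {suc j} eq =
  cong suc (place-distinct R (s ∘ suc) (punchIn-injective _ _ _ eq))

-- Decoding runs from the front: the first position reveals the first symbol, and with it the
-- `punchIn` to be cancelled from all later positions.
place-injective : ∀ R {N} (s t : Fin R → Fin N) → (∀ j → place R s j ≡ place R t j) → ∀ j → s j ≡ t j
place-injective (suc R) s t eq zero    = ↑ʳ-injective (suc R) _ _ (eq zero)
place-injective (suc R) s t eq (suc j) = place-injective R (s ∘ suc) (t ∘ suc) tails j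
  where
  head = place-injective (suc R) s t eq zero
  tails : ∀ j → place R (s ∘ suc) j ≡ place R (t ∘ suc) j
  tails j = punchIn-injective (suc R ↑ʳ s zero) _ _
    (trans (eq (suc j)) (cong (λ a → punchIn (suc R ↑ʳ a) (place R (t ∘ suc) j)) (sym head)))

funToFin-cong : ∀ {m n} {f g : Fin m → Fin n} → (∀ i → f i ≡ g i) → funToFin f ≡ funToFin g
funToFin-cong {zero}  f≗g = refl
funToFin-cong {suc m} f≗g = cong₂ combine (f≗g zero) (funToFin-cong (f≗g ∘ suc))

funToFin-injective : ∀ {m n} {f g : Fin m → Fin n} → funToFin f ≡ funToFin g → ∀ i → f i ≡ g i
funToFin-injective {f = f} {g} eq i =
  trans (sym (finToFun-funToFin f i)) (trans (cong (λ x → finToFun x i) eq) (finToFun-funToFin g i))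

quotient-unique : ∀ d {a b x y} → x < d → y < d → a * d + x ≡ b * d + y → a ≡ b
quotient-unique d x<d y<d eq = ≤-antisym (half y<d eq) (half x<d (sym eq))
  where
  open ≤-Reasoning
  half : ∀ {a b x y} → y < d → a * d + x ≡ b * d + y → a ≤ b
  half {a} {b} {x} {y} y<d eq = m<1+n⇒m≤n (*-cancelʳ-< d a (suc b) (begin-strict
    a * d      ≤⟨ m≤m+n _ x ⟩
    a * d + x  ≡⟨ eq ⟩
    b * d + y  <⟨ +-monoʳ-< (b * d) y<d ⟩
    b * d + d  ≡⟨ +-comm (b * d) d ⟩
    d + b * d  ∎))

mod3 : ℕ → Fin 3
mod3 zero    = zero
mod3 (suc a) = rot (mod3 a)
  where
  rot : Fin 3 → Fin 3
  rot zero             = suc zero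
  rot (suc zero)       = suc (suc zero)
  rot (suc (suc zero)) = zero

mod3-1+ : ∀ a → mod3 a ≢ mod3 (suc a)
mod3-1+ a with mod3 a
... | zero           = λ ()
... | suc zero       = λ ()
... | suc (suc zero) = λ ()

-- This is why levels are recorded modulo 3: the parent and a child of one vertex are two levels
-- apart and must not be confused.
mod3-2+ : ∀ a → mod3 a ≢ mod3 (2 + a)
mod3-2+ a with mod3 a
... | zero           = λ ()
... | suc zero       = λ ()
... | suc (suc zero) = λ ()

-- Levels, addresses and walks in the tree.

search : ∀ {n} k {P : TV n k → Set} → Decidable P → Dec (∃ P)
search zero P? = map′ (center ,_) (λ { (center , p) → p }) (P? center)
search (suc zero) P? = map′
  (λ { (inj₁ p) → center , p ; (inj₂ (i , p)) → leaf i , p })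
  (λ { (center , p) → inj₁ p ; (leaf i , p) → inj₂ (i , p) })
  (P? center ⊎-dec any? (P? ∘ leaf))
search (suc (suc k)) P? = map′
  (λ { (inj₁ p) → center , p ; (inj₂ (i , v , p)) → copy i v , p })
  (λ { (center , p) → inj₁ p ; (copy i v , p) → inj₂ (i , v , p) })
  (P? center ⊎-dec any? (λ i → search (suc k) (P? ∘ copy i)))

level : ∀ {n k} → TV n k → ℕ
level center     = 0
level (leaf i)   = 1
level (copy i v) = suc (level v)

-- digit v e is the branch taken from level e to level e + 1 on the way from the
-- root to v; it is junk (zero) for level v ≤ e.
digit : ∀ {n k} → TV (suc n) k → ℕ → Fin (suc n)
digit center     e       = zero
digit (leaf i)   zero    = i
digit (leaf i)   (suc e) = zero
digit (copy i v) zero    = i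
digit (copy i v) (suc e) = digit v e

AgreeBelow : ∀ {n k} → ℕ → TV (suc n) k → TV (suc n) k → Set
AgreeBelow i u v = ∀ e → e < i → digit u e ≡ digit v e

level≤height : ∀ {n k} (v : TV n k) → level v ≤ k
level≤height center     = z≤n
level≤height (leaf i)   = s≤s z≤n
level≤height (copy i v) = s≤s (level≤height v)

address-injective : ∀ {n k} (u v : TV (suc n) k) → level u ≡ level v → AgreeBelow (level u) u v → u ≡ v
address-injective center     center     _  _ = refl
address-injective (leaf i)   (leaf j)   _  a = cong leaf (a 0 z<s)
address-injective (copy i u) (copy j v) eq a =
  cong₂ copy (a 0 z<s) (address-injective u v (suc-injective eq) (λ e e< → a (suc e) (s≤s e<)))

_IsChildOf_ : ∀ {n k} → TV (suc n) k → TV (suc n) k → Set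
w IsChildOf u = level w ≡ suc (level u) × AgreeBelow (level u) u w

copy-child : ∀ {n k} i {u w : TV (suc n) (suc k)} → w IsChildOf u → copy i w IsChildOf copy i u
copy-child i (lev , agree) = cong suc lev , λ { zero _ → refl ; (suc e) (s≤s e<) → agree e e< }

adjacent : ∀ {n k} {u w : TV (suc n) k} → TAdj (suc n) u w → w IsChildOf u ⊎ u IsChildOf w
adjacent (star-cl i) = inj₁ (refl , λ _ ())
adjacent (star-lc i) = inj₂ (refl , λ _ ())
adjacent (root-cc i) = inj₁ (refl , λ _ ())
adjacent (root-ca i) = inj₂ (refl , λ _ ())
adjacent (inside i a) with adjacent a
... | inj₁ c = inj₁ (copy-child i c)
... | inj₂ c = inj₂ (copy-child i c)

parent : ∀ {n k} (v : TV (suc n) k) {ℓ} → level v ≡ suc ℓ → ∃[ p ] (TAdj (suc n) v p × v IsChildOf p)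
parent (leaf i) eq = center , star-lc i , refl , λ _ ()
parent (copy i center) eq = center , root-ca i , refl , λ _ ()
parent (copy i (leaf j)) eq = copy i center , inside i (star-lc j) , copy-child i (refl , λ _ ())
parent (copy i v@(copy _ _)) eq =
  let p , a , c = parent v refl in copy i p , inside i a , copy-child i c

child : ∀ {n k} (v : TV (suc n) k) → level v < k → ∃[ w ] (TAdj (suc n) v w × w IsChildOf v)
child {k = suc zero}    center lt = leaf zero , star-cl zero , refl , λ _ ()
child {k = suc (suc k)} center lt = copy zero center , root-cc zero , refl , λ _ ()
child (leaf i) (s≤s ())
child (copy i v) (s≤s lt) =
  let w , a , c = child v lt in copy i w , inside i a , copy-child i c

ancestor : ∀ {n k} d (v : TV (suc n) k) {i} → level v ≡ d + i →
  ∃[ a ] (level a ≡ i × Walk (T (suc n) k) v a d × AgreeBelow i v a)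
ancestor zero    v eq = v , eq , here , λ _ _ → refl
ancestor (suc d) v eq =
  let p , adj , lev , agree = parent v eq
      a , la , w , agree′ = ancestor d p (suc-injective (trans (sym lev) eq))
  in a , la , step adj w , λ e e< →
       trans (sym (agree e (≤-trans e< (≤-trans (m≤n+m _ d) (≤-reflexive (suc-injective (trans (sym eq) lev)))))))
             (agree′ e e<)

walk-level : ∀ {n k} {v x : TV (suc n) k} {ℓ} → Walk (T (suc n) k) v x ℓ → level v ≤ ℓ + level x
walk-level here = ≤-refl
walk-level (step a w) with adjacent a
... | inj₁ (lev , _) = ≤-trans (n≤1+n _) (≤-trans (≤-reflexive (sym lev)) (m≤n⇒m≤1+n (walk-level w)))
... | inj₂ (lev , _) = ≤-trans (≤-reflexive lev) (s≤s (walk-level w))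

-- While the walk stays at level `i` or deeper, no step changes the first `i` digits. Otherwise it
-- visits level `i - 1`, and getting there from `v` takes `level v - i + 1` steps.
walk-stays-or-leaves : ∀ {n k} i {v x : TV (suc n) k} {ℓ} → Walk (T (suc n) k) v x ℓ → i ≤ level v →
  AgreeBelow i v x ⊎ level v < ℓ + i
walk-stays-or-leaves i here i≤v = inj₁ λ _ _ → refl
walk-stays-or-leaves i (step a w) i≤v with adjacent a
... | inj₁ (lev , agree)
    with walk-stays-or-leaves i w (≤-trans i≤v (≤-trans (n≤1+n _) (≤-reflexive (sym lev))))
...   | inj₁ agree′ = inj₁ λ e e< → trans (agree e (<-≤-trans e< i≤v)) (agree′ e e<)
...   | inj₂ far = inj₂ (<-trans (≤-reflexive (sym lev)) (m<n⇒m<1+n far))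
walk-stays-or-leaves i {v} (step {w = p} {ℓ = ℓ} a w) i≤v | inj₂ (lev , agree) with i ≤? level p
... | no i≰p = inj₂ (≤-trans (s≤s (≤-trans (≤-reflexive lev) (≰⇒> i≰p))) (s≤s (m≤n+m i ℓ)))
... | yes i≤p with walk-stays-or-leaves i w i≤p
...   | inj₁ agree′ = inj₁ λ e e< → trans (sym (agree e (<-≤-trans e< i≤p))) (agree′ e e<)
...   | inj₂ far = inj₂ (subst (_< suc (ℓ + i)) (sym lev) (s≤s far))

-- Rounds, positions and slots.

symbols : ℕ → ℕ → ℕ
symbols n M = suc n ^ M

roundLength : ℕ → ℕ → ℕ
roundLength n M = symbols n M * M

-- `P` is the number of rounds that receive marks. By `lower`, all their slots lie above the last
-- level `k`, so every marked vertex has a child; by `upper`, every round whose slots must be read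
-- from a deeper vertex is among them. `4N≤Λ` makes the doubled positions fit into one round.
module Coloring (n M P k H : ℕ) .{{_ : NonZero (roundLength n M)}}
  (Λ-even : roundLength n M ≡ 2 * H)
  (4N≤Λ : 4 * symbols n M ≤ roundLength n M)
  (lower : suc P * roundLength n M ≤ k)
  (upper : k < suc (suc P) * roundLength n M)
  where

  N Λ : ℕ
  N = symbols n M
  Λ = roundLength n M

  open ≤-Reasoning

  Vertex : Set
  Vertex = TV (suc n) k

  -- A symbol is a block of `M` consecutive digits. No junk digit enters once `level v` is at least
  -- `suc r * Λ`, which holds at every slot of round `r`.
  word : Vertex → ℕ → Fin N → Fin N
  word v r j = funToFin λ (i : Fin M) → digit v (r * Λ + toℕ (combine j i))

  -- Doubled, so that slots lie on even levels only and the children of a slot vertex have base colors.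
  position : Vertex → ℕ → Fin N → ℕ
  position v r j = 2 * toℕ (place N (word v r) j)

  position<Λ : ∀ v r j → position v r j < Λ
  position<Λ v r j = begin-strict
    2 * toℕ (place N (word v r) j)  <⟨ *-monoʳ-< 2 (toℕ<n (place N (word v r) j)) ⟩
    2 * (N + N)                     ≡⟨ solve 1 (λ a → con 2 :* (a :+ a) := con 4 :* a) refl N ⟩
    4 * N                           ≤⟨ 4N≤Λ ⟩
    Λ                               ∎
    where open +-*-Solver

  -- Only digits from round `r` are read, so all vertices below one vertex at level `suc r * Λ`
  -- share their positions.
  position-cong : ∀ {u v} r → AgreeBelow (suc r * Λ) u v → ∀ j → position u r j ≡ position v r j
  position-cong r agree j = cong (λ p → 2 * toℕ p) (place-cong N
    (λ j → funToFin-cong λ i → agree _ (begin-strict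
      r * Λ + toℕ (combine j i)  <⟨ +-monoʳ-< (r * Λ) (toℕ<n (combine j i)) ⟩
      r * Λ + Λ                  ≡⟨ +-comm (r * Λ) Λ ⟩
      Λ + r * Λ                  ∎)) j)

  position-determines-digits : ∀ u v r → (∀ j → position u r j ≡ position v r j) →
    ∀ (x : Fin Λ) → digit u (r * Λ + toℕ x) ≡ digit v (r * Λ + toℕ x)
  position-determines-digits u v r eq x =
    subst (λ y → digit u (r * Λ + toℕ y) ≡ digit v (r * Λ + toℕ y)) (combine-remQuot {N} M x)
      (funToFin-injective (words (proj₁ ji)) (proj₂ ji))
    where
    ji = remQuot {N} M x
    words = place-injective N (word u r) (word v r)
              (λ j → toℕ-injective (*-cancelˡ-≡ _ _ 2 (eq j)))

  slot : Vertex → ℕ → Fin N → ℕ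
  slot v r j = suc r * Λ + position v r j

  slot-even : ∀ v r j → slot v r j ≡ 2 * (suc r * H + toℕ (place N (word v r) j))
  slot-even v r j = begin-equality
    suc r * Λ + 2 * p        ≡⟨ cong (λ l → suc r * l + 2 * p) Λ-even ⟩
    suc r * (2 * H) + 2 * p  ≡⟨ solve 3 (λ a h p → a :* (con 2 :* h) :+ con 2 :* p := con 2 :* (a :* h :+ p)) refl (suc r) H p ⟩
    2 * (suc r * H + p)      ∎
    where
    open +-*-Solver
    p = toℕ (place N (word v r) j)

  slot<next-round : ∀ v r j → slot v r j < suc (suc r) * Λ
  slot<next-round v r j = begin-strict
    suc r * Λ + position v r j  <⟨ +-monoʳ-< (suc r * Λ) (position<Λ v r j) ⟩
    suc r * Λ + Λ               ≡⟨ +-comm (suc r * Λ) Λ ⟩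
    Λ + suc r * Λ               ∎

  -- The quotient by `Λ` gives the round, and distinctness of the Lehmer positions gives `j`. Hence
  -- no vertex is claimed by two marks.
  slot-injective : ∀ v {r r′ j j′} → slot v r j ≡ slot v r′ j′ → r ≡ r′ × j ≡ j′
  slot-injective v {r} {r′} {j} {j′} eq
    with refl ← quotient-unique Λ {suc r} {suc r′} (position<Λ v r j) (position<Λ v r′ j′) eq =
    refl , place-distinct N (word v r) (toℕ-injective (*-cancelˡ-≡ _ _ 2 (+-cancelˡ-≡ (suc r * Λ) _ _ eq)))

  -- A digit with index e and e + 2 Λ < level v lies in a round whose marks are all above v.
  E : ℕ
  E = suc (2 * Λ)

  -- Counting back from the last digit aligns vertices on the same level. Near the root the
  -- truncated subtraction merely repeats the digit with index 0.
  recentDigit : Vertex → Fin E → Fin (suc n)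
  recentDigit v i = digit v (level v ∸ suc (toℕ i))

  recent : Vertex → Fin (suc n ^ E)
  recent v = funToFin (recentDigit v)

  recent-determines-digits : ∀ {u v} → level u ≡ level v → recent u ≡ recent v →
    ∀ e → e < level u → level u ≤ e + E → digit u e ≡ digit v e
  recent-determines-digits {u} {v} same eq e e<u u≤e+E
    -- `t` is the place of digit `e` counted back from the end, that is, its index in `recent`.
    with t , split ← m≤n⇒∃[o]m+o≡n e<u =
      trans (cong (digit u) (sym (index {u} split refl)))
        (trans (funToFin-injective {f = recentDigit u} {recentDigit v} eq (fromℕ< (t<E split)))
          (cong (digit v) (index {v} split same)))
    where
    t<E : ∀ {t} → suc e + t ≡ level u → t < E
    t<E {t} split = +-cancelˡ-≤ e _ _ (≤-trans (≤-reflexive (trans (+-suc e t) split)) u≤e+E)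
    index : ∀ {x t} (split : suc e + t ≡ level u) → level u ≡ level x →
      level x ∸ suc (toℕ (fromℕ< (t<E split))) ≡ e
    index {t = t} split same = trans
      (cong₂ (λ a b → a ∸ suc b) (trans (sym same) (trans (sym split) (sym (+-suc e t)))) (toℕ-fromℕ< (t<E split)))
      (m+n∸n≡m e (suc t))

  -- The colors and the properness of the coloring.

  Color : Set
  Color = Fin 1 ⊎ ((Fin 3 × Fin (suc n ^ E)) ⊎ (Fin P × Fin N))

  pattern rootColor = inj₁ zero
  pattern base a w  = inj₂ (inj₁ (a , w))
  pattern mark r j  = inj₂ (inj₂ (r , j))

  IsSlot : Vertex → Fin P → Fin N → Set
  IsSlot v r j = level v ≡ slot v (toℕ r) j

  -- The graph of the coloring: matching on `color v` and `colorView v` together turns a color back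
  -- into the condition that produced it.
  data ColorView (v : Vertex) : Color → Set where
    isMark : ∀ r j → IsSlot v r j → ColorView v (mark r j)
    isRoot : level v ≡ 0 → ColorView v rootColor
    isBase : 0 < level v → (∀ r j → ¬ IsSlot v r j) → ColorView v (base (mod3 (level v)) (recent v))

  classify : ∀ v → ∃ (ColorView v)
  classify v with any? (λ r → any? λ j → level v ≟ slot v (toℕ r) j) | level v ≟ 0
  ... | yes (r , j , s) | _      = _ , isMark r j s
  ... | no _            | yes z  = _ , isRoot z
  ... | no none         | no v≢0 = _ , isBase (n≢0⇒n>0 v≢0) λ r j s → none (r , j , s)

  color : Vertex → Color
  color = proj₁ ∘ classify

  colorView : ∀ v → ColorView v (color v)
  colorView = proj₂ ∘ classify

  slot-positive : ∀ v r j → 0 < slot v r j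
  slot-positive v r j = <-≤-trans (≤-<-trans z≤n (position<Λ v r j)) (≤-trans (m≤m+n Λ _) (m≤m+n _ (position v r j)))

  IsSlot⇒color : ∀ {v} r j → IsSlot v r j → color v ≡ mark r j
  IsSlot⇒color {v} r j s with color v | colorView v
  ... | _ | isMark r′ j′ s′ with er , refl ← slot-injective v {toℕ r′} {toℕ r} {j′} {j} (trans (sym s′) s)
        = cong (λ r → mark r j) (toℕ-injective er)
  ... | _ | isRoot z = contradiction (slot-positive v (toℕ r) j) (subst (λ x → ¬ 0 < x) (trans (sym z) s) λ ())
  ... | _ | isBase _ none = contradiction s (none r j)

  mark⇒IsSlot : ∀ {v} r j → color v ≡ mark r j → IsSlot v r j
  mark⇒IsSlot {v} r j eq with color v | colorView v
  mark⇒IsSlot r j refl | _ | isMark _ _ s = s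

  root⇒level≡0 : ∀ {v} → color v ≡ rootColor → level v ≡ 0
  root⇒level≡0 {v} eq with color v | colorView v
  root⇒level≡0 refl | _ | isRoot z = z

  level≡0⇒root : ∀ {v} → level v ≡ 0 → color v ≡ rootColor
  level≡0⇒root {v} z with color v | colorView v
  ... | _ | isMark r j s = contradiction (slot-positive v (toℕ r) j) (subst (λ x → ¬ 0 < x) (trans (sym z) s) λ ())
  ... | _ | isRoot _ = refl
  ... | _ | isBase pos _ = contradiction z (m<n⇒n≢0 pos)

  base⇒ : ∀ {v a w} → color v ≡ base a w → mod3 (level v) ≡ a × recent v ≡ w
  base⇒ {v} eq with color v | colorView v
  base⇒ refl | _ | isBase _ _ = refl , refl

  -- Parity: every slot is an even level, so the level after a slot is odd and carries no marks.
  below-slot : ∀ {v y} r j → IsSlot v r j → level y ≡ suc (level v) → color y ≡ base (mod3 (level y)) (recent y)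
  below-slot {v} {y} r j s lev with color y | colorView y
  ... | _ | isMark r′ j′ s′ = contradiction
        (trans (sym (slot-even y (toℕ r′) j′)) (trans (sym s′) (trans lev (cong suc (trans s (slot-even v (toℕ r) j))))))
        (even≢odd (suc (toℕ r′) * H + toℕ (place N (word y (toℕ r′)) j′))
                  (suc (toℕ r) * H + toℕ (place N (word v (toℕ r)) j)))
  ... | _ | isRoot z = contradiction (trans (sym lev) z) λ ()
  ... | _ | isBase _ _ = refl

  child-color-differs : ∀ {u w} → w IsChildOf u → color u ≢ color w
  child-color-differs {u} {w} (lev , _) eq with color u in cu | colorView u
  ... | _ | isRoot _ = contradiction (trans (sym lev) (root⇒level≡0 (sym eq))) λ ()
  ... | _ | isMark r j s = contradiction (trans eq (below-slot r j s lev)) λ ()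
  ... | _ | isBase _ _ = mod3-1+ (level u) (trans (sym (proj₁ (base⇒ (sym eq)))) (cong mod3 lev))

  color-proper : ∀ {u w} → TAdj (suc n) u w → color u ≢ color w
  color-proper a eq with adjacent a
  ... | inj₁ c = child-color-differs c eq
  ... | inj₂ c = child-color-differs c (sym eq)

  q : ℕ
  q = 1 + (3 * suc n ^ E + P * N)

  encoding : Color ↔ Fin q
  encoding = ↔-sym (↔-trans +↔⊎ (↔-refl ⊎-↔ ↔-trans +↔⊎ (*↔× ⊎-↔ *↔×)))

  encode : Color → Fin q
  encode = Inverse.to encoding

  encode-injective : Injective _≡_ _≡_ encode
  encode-injective = Injection.injective (Inverse⇒Injection encoding)

  -- Distances from a vertex to the color classes.

  G : Graph
  G = T (suc n) k

  c : Vertex → Fin q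
  c = encode ∘ color

  Dist : Vertex → Color → ℕ → Set
  Dist v a = DistToClass G c v (encode a)

  -- The root is alone in its class, so the color code contains the level.
  dist-root : ∀ v → Dist v rootColor (level v)
  dist-root v =
    let a , la , w , _ = ancestor (level v) v (sym (+-identityʳ _))
    in (a , cong encode (level≡0⇒root la) , w) , λ x ℓ cx w′ → begin
         level v      ≤⟨ walk-level w′ ⟩
         ℓ + level x  ≡⟨ cong (ℓ +_) (root⇒level≡0 (encode-injective cx)) ⟩
         ℓ + 0        ≡⟨ +-identityʳ ℓ ⟩
         ℓ            ∎

  -- A walk to the class of mark r j either stays below the ancestor of v at level (r + 1) Λ,
  -- where the class is exactly one level, or climbs above that ancestor.
  dist-mark : ∀ v r j → suc (suc (toℕ r)) * Λ ≤ level v → Dist v (mark r j) (level v ∸ slot v (toℕ r) j)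
  dist-mark v r j deep =
    let a , la , w , agree = ancestor (level v ∸ s) v (sym (m∸n+n≡m s≤v))
        sa = position-cong {v} {a} (toℕ r) (λ e e< → agree e (<-≤-trans e< (m≤m+n _ _))) j
    in (a , cong encode (IsSlot⇒color r j (trans la (cong (suc (toℕ r) * Λ +_) sa))) , w) , closest
    where
    s = slot v (toℕ r) j
    s≤v : s ≤ level v
    s≤v = ≤-trans (<⇒≤ (slot<next-round v (toℕ r) j)) deep
    closest : ∀ x ℓ → c x ≡ encode (mark r j) → Walk G v x ℓ → level v ∸ s ≤ ℓ
    closest x ℓ cx w = m≤n+o⇒m∸n≤o (level v) s (subst (level v ≤_) (+-comm ℓ s) bound)
      where
      bound : level v ≤ ℓ + s
      bound with walk-stays-or-leaves (suc (toℕ r) * Λ) w (≤-trans (m≤m+n _ _) s≤v)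
      ... | inj₁ agree = begin
              level v              ≤⟨ walk-level w ⟩
              ℓ + level x          ≡⟨ cong (ℓ +_) (mark⇒IsSlot r j (encode-injective cx)) ⟩
              ℓ + slot x (toℕ r) j ≡⟨ cong (λ p → ℓ + (suc (toℕ r) * Λ + p)) (position-cong {v} {x} (toℕ r) agree j) ⟨
              ℓ + s                ∎
      ... | inj₂ far = ≤-trans (<⇒≤ far) (+-monoʳ-≤ ℓ (m≤m+n _ _))

  dist-self : ∀ v → Dist v (color v) 0
  dist-self v = (v , refl , here) , λ _ _ _ _ → z≤n

  -- Properness excludes distance 0. An entry 1 in the code thus tells which colors occur next to a
  -- vertex.
  dist-neighbour : ∀ {v y} → TAdj (suc n) v y → Dist v (color y) 1
  dist-neighbour {v} {y} a = (y , refl , step a here) , closest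
    where
    closest : ∀ x ℓ → c x ≡ c y → Walk G v x ℓ → 1 ≤ ℓ
    closest x zero    cx here = contradiction (encode-injective cx) (color-proper a)
    closest x (suc ℓ) cx w    = s≤s z≤n

  -- Equal color codes force equal vertices.

  module Separation {u v : Vertex} (same : ∀ i d → DistToClass G c u i d → DistToClass G c v i d) where

    same-level : level u ≡ level v
    same-level = DistToClass-unique {G} (same _ _ (dist-root u)) (dist-root v)

    same-color : color v ≡ color u
    same-color with (x , cx , here) , _ ← same _ _ (dist-self u) = encode-injective cx

    -- A mark hides the recent digits of `u`, but a child `y` of `u` shows them in its base color.
    -- Equal codes give `v` a neighbor `y′` of that color. If `y′` is a child of `v`, the digits of
    -- `y` and `y′` pass to their parents; the window `E` has one digit more than `2 * Λ` to absorb
    -- the extra level.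
    same-recent-below-slot : ∀ r j → IsSlot u r j → ∀ e → e < level u → level u ≤ e + 2 * Λ → digit u e ≡ digit v e
    same-recent-below-slot r j s e e<u u≤
      -- A child exists because the slot lies below `(r + 2) Λ`, which is at most `(P + 1) Λ` and
      -- hence at most `k`.
      with y , uy , ly , ay ← child u (<-≤-trans (≤-<-trans (≤-reflexive s) (slot<next-round u (toℕ r) j))
             (≤-trans (*-monoˡ-≤ Λ (s≤s (toℕ<n r))) lower))
      with (y′ , cy′ , step vy′ here) , _ ← same _ _ (dist-neighbour uy)
      with mod-eq , recent-eq ← base⇒ (trans (encode-injective cy′) (below-slot r j s ly))
      with adjacent vy′
    ... | inj₁ (ly′ , ay′) =
          trans (ay e e<u) (trans
            (recent-determines-digits {y} {y′} (trans ly (trans (cong suc same-level) (sym ly′))) (sym recent-eq) e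
              (≤-trans e<u (≤-trans (n≤1+n _) (≤-reflexive (sym ly))))
              (≤-trans (≤-reflexive ly) (≤-trans (s≤s u≤) (≤-reflexive (sym (+-suc e (2 * Λ)))))))
            (sym (ay′ e (subst (e <_) same-level e<u))))
    -- Were `y′` the parent of `v`, its level would be two less than that of `y`, against the equal
    -- residues modulo 3.
    ... | inj₂ (lv , _) = contradiction (trans mod-eq (cong mod3 (trans ly (cong suc (trans same-level lv))))) (mod3-2+ (level y′))

    same-recent : ∀ e → e < level u → level u ≤ e + 2 * Λ → digit u e ≡ digit v e
    same-recent e e<u u≤ with color u in cu | colorView u
    ... | _ | isMark r j s = same-recent-below-slot r j s e e<u u≤
    ... | _ | isRoot z = contradiction (subst (e <_) z e<u) λ ()
    ... | _ | isBase _ _ = recent-determines-digits {u} {v} same-level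
          (sym (proj₂ (base⇒ (trans same-color cu)))) e e<u (≤-trans u≤ (+-monoʳ-≤ e (n≤1+n _)))

    -- Distance to the class of `mark r j` plus slot equals level. Levels and distances agree for
    -- `u` and `v`, hence so do the slots.
    same-position : ∀ r → suc (suc r) * Λ ≤ level u → ∀ j → position u r j ≡ position v r j
    same-position r deep j = +-cancelˡ-≡ (suc r * Λ) _ _
      (∸-cancelˡ-≡ (slot≤ u deep) (subst (slot v r j ≤_) (sym same-level) (slot≤ v deep-v)) (begin-equality
        level u ∸ slot u r j  ≡⟨ distances ⟩
        level v ∸ slot v r j  ≡⟨ cong (_∸ slot v r j) same-level ⟨
        level u ∸ slot v r j  ∎))
      where
      deep-v = subst (suc (suc r) * Λ ≤_) same-level deep
      slot≤ : ∀ x → suc (suc r) * Λ ≤ level x → slot x r j ≤ level x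
      slot≤ x d = ≤-trans (<⇒≤ (slot<next-round x r j)) d
      -- `(r + 2) Λ ≤ level u ≤ k < (P + 2) Λ`, so round `r` does have marks.
      r<P : r < P
      r<P = +-cancelˡ-< 2 r P (*-cancelʳ-< Λ (2 + r) (2 + P) (≤-<-trans (≤-trans deep (level≤height u)) upper))
      distances : level u ∸ slot u r j ≡ level v ∸ slot v r j
      distances with fromℕ< r<P | toℕ-fromℕ< r<P
      ... | r′ | refl = DistToClass-unique {G} (same _ _ (dist-mark u r′ j deep)) (dist-mark v r′ j deep-v)

    same-digits : AgreeBelow (level u) u v
    same-digits e e<u with level u ≤? e + 2 * Λ
    ... | yes u≤ = same-recent e e<u u≤
    -- An older digit `e` belongs to round `e / Λ`; all slots of that round are at smaller levels
    -- than `u`, so its positions can be compared.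
    ... | no u≰ = subst (λ e → digit u e ≡ digit v e) index
            (position-determines-digits u v r (same-position r deep) x)
      where
      r = e / Λ
      x = fromℕ< (m%n<n e Λ)
      index : r * Λ + toℕ x ≡ e
      index = begin-equality
        r * Λ + toℕ x  ≡⟨ cong (r * Λ +_) (toℕ-fromℕ< (m%n<n e Λ)) ⟩
        r * Λ + e % Λ  ≡⟨ +-comm (r * Λ) (e % Λ) ⟩
        e % Λ + r * Λ  ≡⟨ m≡m%n+[m/n]*n e Λ ⟨
        e              ∎
      deep : suc (suc r) * Λ ≤ level u
      deep = begin
        Λ + (Λ + r * Λ)  ≡⟨ solve 2 (λ l m → l :+ (l :+ m) := m :+ con 2 :* l) refl Λ (r * Λ) ⟩
        r * Λ + 2 * Λ    ≤⟨ +-monoˡ-≤ (2 * Λ) (m/n*n≤m e Λ) ⟩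
        e + 2 * Λ        ≤⟨ <⇒≤ (≰⇒> u≰) ⟩
        level u          ∎
        where open +-*-Solver

  color-separates : SeparatesCodes G c
  color-separates u v same = address-injective u v same-level same-digits
    where open Separation same

  few-colors : ∃[ j ] (j ≤ q × HasLocatingColoring G j)
  few-colors = drop-empty-classes G (search k) q c (λ u w a eq → color-proper a (encode-injective eq)) color-separates

-- Counting the colors and passing to the limit.

quotient-bounds : ∀ k d .{{_ : NonZero d}} → d ≤ k → ∃[ p ] (suc p * d ≤ k × k < suc (suc p) * d)
quotient-bounds k d d≤k with k / d in eq | m≥n⇒m/n>0 d≤k
... | suc p | _ = p , subst (λ x → x * d ≤ k) eq (m/n*n≤m k d) , (begin-strict
  k                  ≡⟨ m≡m%n+[m/n]*n k d ⟩
  k % d + k / d * d  ≡⟨ cong (λ x → k % d + x * d) eq ⟩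
  k % d + suc p * d  <⟨ +-monoˡ-< (suc p * d) (m%n<n k d) ⟩
  d + suc p * d      ∎)
  where open ≤-Reasoning

-- The two kinds of colors, each multiplied by `m`, contribute at most `k / 4` apiece.
color-count : ∀ m b a {k} → 4 * (m * b) < k → a * (4 * m) ≤ k → m * (b + a) < k
color-count m b a {k} b-small a-small = *-cancelˡ-< 4 (m * (b + a)) k (begin-strict
  4 * (m * (b + a))            ≡⟨ solve 3 (λ m b a → con 4 :* (m :* (b :+ a)) := con 4 :* (m :* b) :+ a :* (con 4 :* m)) refl m b a ⟩
  4 * (m * b) + a * (4 * m)    <⟨ +-mono-<-≤ b-small a-small ⟩
  k + k                        ≤⟨ m≤m+n (k + k) (2 * k) ⟩
  k + k + 2 * k                ≡⟨ solve 1 (λ k → k :+ k :+ con 2 :* k := con 4 :* k) refl k ⟩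
  4 * k                        ∎)
  where
  open ≤-Reasoning
  open +-*-Solver

theorem3 : (n : ℕ) → 3 ≤ n → (m : ℕ) → 1 ≤ m →
    ∃[ K ] (∀ k → K ≤ k → 1 ≤ k → ∀ χ → IsLocChromNumber (T n k) χ → m * χ < k)
-- The first summand makes the bounded number `b` of colors negligible against `k`; the second gives
-- `Λ ≤ k`, so that `P` exists.
theorem3 (suc n) _ m 1≤m = suc (4 * (m * b) + Λ) , bound
  where
  M = 4 * m
  N = suc n ^ M
  Λ = N * M
  -- The root color and the base colors: `q` unfolds to `b + P * N`.
  b = 1 + 3 * suc n ^ suc (2 * Λ)

  instance
    M≢0 : NonZero M
    M≢0 = >-nonZero (*-mono-≤ {1} {4} z<s 1≤m)
    Λ≢0 : NonZero Λ
    Λ≢0 = m*n≢0 N M {{m^n≢0 (suc n) M}}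

  Λ-even : Λ ≡ 2 * (N * (2 * m))
  Λ-even = solve 2 (λ N m → N :* (con 4 :* m) := con 2 :* (N :* (con 2 :* m))) refl N m
    where open +-*-Solver

  4N≤Λ : 4 * N ≤ Λ
  4N≤Λ = ≤-trans (≤-reflexive (*-comm 4 N)) (*-monoʳ-≤ N (*-monoʳ-≤ 4 1≤m))

  bound : ∀ k → suc (4 * (m * b) + Λ) ≤ k → 1 ≤ k → ∀ χ → IsLocChromNumber (T (suc n) k) χ → m * χ < k
  bound k K≤k _ χ (_ , minimal) =
    let P , lower , upper = quotient-bounds k Λ (≤-trans (m≤n+m Λ (suc (4 * (m * b)))) K≤k)
        j , j≤q , colorable = Coloring.few-colors n M P k (N * (2 * m)) Λ-even 4N≤Λ lower upper
    in ≤-<-trans (*-monoʳ-≤ m (≤-trans (≮⇒≥ λ j<χ → minimal j j<χ colorable) j≤q))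
      (color-count m b (P * N) (≤-trans (s≤s (m≤m+n _ Λ)) K≤k)
        (≤-trans (≤-reflexive (*-assoc P N M)) (≤-trans (m≤n+m (P * Λ) Λ) lower)))
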